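{- For every finite simple connected planar graph $G$ with $n$ vertices and $m$ edges, $D(G) \le \frac{4(n-1)-m}{3}$.
   Context: $D(G)$ is the diameter of $G$: the maximum over all pairs of vertices of the distance (minimum number of edges on a path) between them. -}

module Defs where

open import Data.Bool.Base using (Bool; T)
open import Data.Bool.Properties using (T?)
open import Data.Fin.Base using (Fin)
open import Data.Fin.Properties using (all?) renaming (_<?_ to _<ᶠ?_)
open import Data.List.Base using (List; []; _∷_; allFin; cartesianProduct; filter; length)
open import Data.List.Relation.Unary.Unique.Propositional using (Unique)
open import Data.Nat.Base using (ℕ; zero; suc; _+_; _*_; _≤_; NonZero)
open import Data.Nat.GeneralisedArithmetic using (iterate)
open import Data.Product.Base using (_×_; _,_; proj₁; ∃-syntax; Σ-syntax)
open import Function.Bundles using (_⇔_; _↔_; Inverse)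
open import Function.Definitions using (Surjective)
open import Level using (Level; _⊔_)
open import Relation.Binary.Construct.Closure.ReflexiveTransitive using (Star; ε; _◅_)
open import Relation.Binary.PropositionalEquality.Core using (_≡_)
open import Relation.Nullary.Decidable.Core using (Dec; ¬?; _×-dec_)
open import Relation.Nullary.Negation.Core using (¬_)

record Graph (n : ℕ) : Set where
  field
    adj    : Fin n → Fin n → Bool
    sym    : ∀ {u v} → T (adj u v) → T (adj v u)
    irrefl : ∀ {v} → ¬ T (adj v v)

  Vertex : Set
  Vertex = Fin n

  Adj : Vertex → Vertex → Set
  Adj u v = T (adj u v)

  -- An unordered edge {u , v} is listed once, as the pair with u < v.
  edges : List (Vertex × Vertex)
  edges = filter (λ (u , v) → (u <ᶠ? v) ×-dec T? (adj u v))
                 (cartesianProduct (allFin n) (allFin n))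

  size : ℕ
  size = length edges

  Walk : Vertex → Vertex → Set
  Walk = Star Adj

  vertices : ∀ {u v} → Walk u v → List Vertex
  vertices {u} ε       = u ∷ []
  vertices {u} (_ ◅ w) = u ∷ vertices w

  ∣_∣ʷ : ∀ {u v} → Walk u v → ℕ
  ∣ ε ∣ʷ     = zero
  ∣ _ ◅ w ∣ʷ = suc ∣ w ∣ʷ

  Path : Vertex → Vertex → Set
  Path u v = Σ[ w ∈ Walk u v ] Unique (vertices w)

  ∣_∣ᵖ : ∀ {u v} → Path u v → ℕ
  ∣ p ∣ᵖ = ∣ proj₁ p ∣ʷ

  Connected : Set
  Connected = NonZero n × (∀ u v → Path u v)

  IsDistance : Vertex → Vertex → ℕ → Set
  IsDistance u v d = (∃[ p ] ∣_∣ᵖ {u} {v} p ≡ d) × (∀ (p : Path u v) → d ≤ ∣ p ∣ᵖ)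

  IsDiameter : ℕ → Set
  IsDiameter D = (∃[ u ] ∃[ v ] IsDistance u v D)
               × (∀ u v d → IsDistance u v d → d ≤ D)

  Isolated : Vertex → Set
  Isolated u = ∀ v → ¬ Adj u v

  isolated? : ∀ u → Dec (Isolated u)
  isolated? u = all? λ v → ¬? (T? (adj u v))

  #isolated : ℕ
  #isolated = length (filter isolated? (allFin n))

  -- Every edge {u , v} gives two darts, u → v and v → u.
  record Dart : Set where
    constructor dart
    field
      {tail head} : Vertex
      adjacent    : Adj tail head

  open Dart public

  rev : Dart → Dart
  rev d = dart (sym (adjacent d))

-- R, as an equivalence relation, has exactly k classes.
record HasClasses {a r : Level} {A : Set a} (R : A → A → Set r) (k : ℕ) : Set (a ⊔ r) where
  field
    class      : A → Fin k
    surjective : Surjective _≡_ _≡_ class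
    classifies : ∀ x y → R x y ⇔ class x ≡ class y

-- For a permutation f of a finite set, forward iterates already give the
-- whole cycle of x.
SameCycle : {a : Level} {A : Set a} → (A → A) → A → A → Set a
SameCycle f x y = ∃[ k ] iterate f x k ≡ y

-- Planarity is taken in the combinatorial (Heffter–Edmonds) sense: a drawing
-- on an oriented closed surface is recorded by the cyclic order of the darts
-- around each vertex, and the surface is required to have genus 0.
module _ {n : ℕ} (G : Graph n) where
  open Graph G

  record RotationSystem : Set where
    field
      rotation : Dart ↔ Dart
      cyclic   : ∀ d e → SameCycle (Inverse.to rotation) d e ⇔ tail d ≡ tail e

    -- Reversing a dart and then turning to the next one at its new tail walks
    -- along the boundary of a face.
    nextOnFace : Dart → Dart
    nextOnFace d = Inverse.to rotation (rev d)

  -- Each component is drawn on its own surface, so genus 0 for all of them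
  -- means V − E + F = 2C.  The face around an isolated vertex has no dart on
  -- its boundary and is counted through #isolated.
  record PlaneEmbedding : Set where
    field
      rotationSystem : RotationSystem
    open RotationSystem rotationSystem public
    field
      #faces      : ℕ
      #components : ℕ
      faces       : HasClasses (SameCycle nextOnFace) #faces
      components  : HasClasses Path #components
      euler       : n + (#faces + #isolated) ≡ size + 2 * #components

  Planar : Set
  Planar = PlaneEmbedding

-- Let the level of a vertex be its distance to an end v of a diametral path, let l_k be
-- the number of vertices of level k, and let D be the level of the other end.  Summing
-- over 0 < k < D, the excess Σ max(0, 3 − l_k) is at least 3D − 1 − n.
-- Each unit of excess is paid for by a mark on a dart of a face.  At level k with l_k ≤ 2
-- some vertex a has neighbours on both adjacent levels and at most one on its own, so the
-- rotation around a turns directly from below to above or back, and a face climbs or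
-- descends through a; if l_k = 1 it does both.  The dart of that face entering a is marked.
-- A face whose unmarked darts are fewer than three runs straight up and back down the same
-- edges; it is then closed under reversal, so by connectivity it is the only face.
-- Hence either F ≤ 1, or 3F + (3D − 1 − n) ≤ 2m, and Euler's formula n + F = m + 2 gives
-- 3D + m ≤ 4(n − 1) in both cases.
module Submission where

open import Defs
open import Data.Bool.Properties using (T?; T-irrelevant)
open import Data.Fin.Base using (Fin; zero; suc; toℕ)
open import Data.Fin.Properties using (any?; toℕ-injective; toℕ<n; <-cmp; _≟_) renaming (_<?_ to _<ᶠ?_)
import Data.Integer.Base as ℤ
import Data.Integer.Properties as ℤₚ
import Data.Integer.Tactic.RingSolver as ℤ-Solver
open import Data.List.Base using (List; []; _∷_; _++_; allFin; cartesianProduct; concatMap; filter; length; map)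
open import Data.List.Membership.Propositional using (_∈_; _∉_; find; lose)
open import Data.List.Membership.Propositional.Properties
open import Data.List.Properties using (filter-none; length-++; length-++-sucʳ; length-map; length-tabulate)
open import Data.List.Relation.Binary.Disjoint.Propositional using (Disjoint)
open import Data.List.Relation.Binary.Subset.Propositional using (_⊆_)
open import Data.List.Relation.Unary.All as All using (All; []; _∷_)
open import Data.List.Relation.Unary.AllPairs using ([]; _∷_)
open import Data.List.Relation.Unary.Any as Any using (here; there)
open import Data.List.Relation.Unary.Unique.Propositional using (Unique)
open import Data.List.Relation.Unary.Unique.Propositional.Properties as Unique using (allFin⁺)
open import Data.Nat.Base using (ℕ; zero; suc; pred; _+_; _*_; _≤_; _<_; z≤n; s≤s; s≤s⁻¹)
open import Data.Nat.GeneralisedArithmetic using (iterate)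
open import Data.Nat.Properties as ℕ using (≤-refl; ≤-trans; ≤-reflexive; ≤-antisym; n≤1+n)
open import Data.List.Extrema ℕ.≤-totalOrder using (argmax; argmax-all; argmin; argmin-all; f[argmin]≤f[xs]; f[xs]≤f[argmax])
open import Data.Nat.Tactic.RingSolver using (solve-∀)
open import Data.Product.Base using (_×_; _,_; proj₁; proj₂; ∃-syntax; Σ-syntax; swap)
open import Data.Product.Properties using (,-injectiveˡ; ,-injectiveʳ)
import Data.Rational.Base as ℚ
import Data.Rational.Properties as ℚₚ
import Data.Rational.Unnormalised.Base as ℚᵘ
import Data.Rational.Unnormalised.Properties as ℚᵘₚ
open import Data.Sum.Base as Sum using (_⊎_; inj₁; inj₂)
open import Function.Base using (_∘_)
open import Function.Bundles using (Equivalence; Inverse)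
open import Relation.Binary.Construct.Closure.ReflexiveTransitive using (ε; _◅_)
open import Relation.Binary.Definitions using (tri<; tri≈; tri>)
open import Relation.Binary.PropositionalEquality
open import Relation.Nullary.Decidable.Core using (Dec; yes; no; ¬?; _×-dec_; _⊎-dec_; map′)
open import Relation.Nullary.Negation.Core using (¬_; contradiction)

-- Iteration of maps, and counting with lists that have no repetitions.

iterate-preserves : {A : Set} {f : A → A} (P : A → Set) → (∀ {x} → P x → P (f x)) →
                    ∀ k {x} → P x → P (iterate f x k)
iterate-preserves P step zero    px = px
iterate-preserves P step (suc k) px = iterate-preserves P step k (step px)

-- Since `Z` always leads straight back to `N`, the orbit can enter `P` only from `N`. Used on the
-- rotation around a vertex, with `Z` the darts that stay on its level.
direct-transition : {A : Set} (f : A → A) {N Z P : A → Set} →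
  (∀ {x} → N x → ¬ P x) → (∀ {x} → Z x → ¬ P x) →
  (∀ {x} → N x → N (f x) ⊎ Z (f x) ⊎ P (f x)) → (∀ {x} → Z x → N (f x)) →
  ∀ k {x} → N x ⊎ Z x → P (iterate f x k) → ∃[ y ] N y × P (f y)
direct-transition f ¬np ¬zp fromN fromZ zero    (inj₁ nx) px = contradiction px (¬np nx)
direct-transition f ¬np ¬zp fromN fromZ zero    (inj₂ zx) px = contradiction px (¬zp zx)
direct-transition f ¬np ¬zp fromN fromZ (suc k) (inj₂ zx) p  =
  direct-transition f ¬np ¬zp fromN fromZ k (inj₁ (fromZ zx)) p
direct-transition f ¬np ¬zp fromN fromZ (suc k) (inj₁ nx) p with fromN nx
... | inj₁ n        = direct-transition f ¬np ¬zp fromN fromZ k (inj₁ n) p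
... | inj₂ (inj₁ z) = direct-transition f ¬np ¬zp fromN fromZ k (inj₂ z) p
... | inj₂ (inj₂ q) = _ , nx , q

unique-⊆⇒length≤ : {A : Set} {xs ys : List A} → Unique xs → xs ⊆ ys → length xs ≤ length ys
unique-⊆⇒length≤ {xs = []}     _         _     = z≤n
unique-⊆⇒length≤ {A} {x ∷ xs} (x∉ ∷ u) sub with ∈-∃++ (sub (here refl))
... | as , bs , refl = ≤-trans (s≤s (unique-⊆⇒length≤ u sub′))
                                (≤-reflexive (sym (length-++-sucʳ as x bs)))
  where
  sub′ : xs ⊆ as ++ bs
  sub′ z∈ with ∈-++⁻ as (sub (there z∈))
  ... | inj₁ z∈as           = ∈-++⁺ˡ z∈as
  ... | inj₂ (here refl)    = contradiction refl (All.lookup x∉ z∈)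
  ... | inj₂ (there z∈bs)   = ∈-++⁺ʳ as z∈bs

module _ {K A : Set} (f : K → List A) where

  concatMap-unique : (∀ {k k′ x} → x ∈ f k → x ∈ f k′ → k ≡ k′) → (∀ k → Unique (f k)) →
                     ∀ {ks} → Unique ks → Unique (concatMap f ks)
  concatMap-unique same uf {[]}     _          = []
  concatMap-unique same uf {k ∷ ks} (k∉ ∷ uks) =
    Unique.++⁺ (uf k) (concatMap-unique same uf uks) disjoint
    where
    disjoint : Disjoint (f k) (concatMap f ks)
    disjoint (x∈k , x∈ks) with find (∈-concatMap⁻ f {xs = ks} x∈ks)
    ... | k′ , k′∈ , x∈k′ = All.lookup k∉ k′∈ (same x∈k x∈k′)

  ∈-concatMap⁻′ : ∀ {ks x} → x ∈ concatMap f ks → ∃[ k ] x ∈ f k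
  ∈-concatMap⁻′ {ks} x∈ with find (∈-concatMap⁻ f {xs = ks} x∈)
  ... | k , _ , x∈k = k , x∈k

  length-concatMap-const : ∀ {c} → (∀ k → length (f k) ≡ c) →
                           ∀ ks → length (concatMap f ks) ≡ length ks * c
  length-concatMap-const eq []       = refl
  length-concatMap-const eq (k ∷ ks) =
    trans (length-++ (f k)) (cong₂ _+_ (eq k) (length-concatMap-const eq ks))

-- Only the two contributions of each `k` together reach `c`: a level with few vertices makes up for
-- them by marks.
length-concatMap₂-≥ : {K A B : Set} (f : K → List A) (g : K → List B) {c : ℕ} →
  (∀ k → c ≤ length (f k) + length (g k)) →
  ∀ ks → length ks * c ≤ length (concatMap f ks) + length (concatMap g ks)
length-concatMap₂-≥ f g c≤ []       = z≤n
length-concatMap₂-≥ f g c≤ (k ∷ ks)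
  rewrite length-++ (f k) {concatMap f ks} | length-++ (g k) {concatMap g ks} =
  ≤-trans (ℕ.+-mono-≤ (c≤ k) (length-concatMap₂-≥ f g c≤ ks))
          (≤-reflexive (interchange (length (f k)) _ _ _))
  where
  interchange : ∀ a b c d → (a + b) + (c + d) ≡ (a + c) + (b + d)
  interchange = solve-∀

length-allFin : ∀ n → length (allFin n) ≡ n
length-allFin n = length-tabulate (λ i → i)

unique-vertices⇒length≤ : ∀ {n} {vs : List (Fin n)} → Unique vs → length vs ≤ n
unique-vertices⇒length≤ {n} {vs} u =
  subst (length vs ≤_) (length-allFin n) (unique-⊆⇒length≤ u (λ {v} _ → ∈-allFin v))

-- Darts, at most two per edge.

module DartCount {n : ℕ} (G : Graph n) where
  open Graph G renaming (sym to adj-sym)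

  dart-≡ : {d e : Dart} → tail d ≡ tail e → head d ≡ head e → d ≡ e
  dart-≡ {dart a} {dart b} refl refl = cong dart (T-irrelevant a b)

  _≟ᵈ_ : (d e : Dart) → Dec (d ≡ e)
  d ≟ᵈ e = map′ (λ (p , q) → dart-≡ p q) (λ { refl → refl , refl })
                ((tail d ≟ tail e) ×-dec (head d ≟ head e))

  rev-involutive : ∀ d → rev (rev d) ≡ d
  rev-involutive d = dart-≡ refl refl

  loopless : ∀ d → tail d ≢ head d
  loopless d eq = irrefl (subst (Adj (tail d)) (sym eq) (adjacent d))

  ends : Dart → Vertex × Vertex
  ends d = tail d , head d

  ends-injective : ∀ {d e} → ends d ≡ ends e → d ≡ e
  ends-injective eq = dart-≡ (,-injectiveˡ eq) (,-injectiveʳ eq)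

  dartsBetween : Vertex × Vertex → List Dart
  dartsBetween (u , v) with T? (adj u v)
  ... | yes a = dart a ∷ []
  ... | no  _ = []

  ∈-dartsBetween : ∀ d → d ∈ dartsBetween (ends d)
  ∈-dartsBetween d with T? (adj (tail d) (head d))
  ... | yes a = here (dart-≡ refl refl)
  ... | no ¬a = contradiction (adjacent d) ¬a

  darts : List Dart
  darts = concatMap dartsBetween (cartesianProduct (allFin n) (allFin n))

  ∈-darts : ∀ d → d ∈ darts
  ∈-darts d = ∈-concatMap⁺ dartsBetween
    (lose (∈-cartesianProduct⁺ (∈-allFin (tail d)) (∈-allFin (head d))) (∈-dartsBetween d))

  ends∈ : ∀ d → ends d ∈ edges ++ map swap edges
  ends∈ d with <-cmp (tail d) (head d)
  ... | tri< t<h _ _ = ∈-++⁺ˡ (∈-filter⁺ (λ (u , v) → (u <ᶠ? v) ×-dec T? (adj u v))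
          (∈-cartesianProduct⁺ (∈-allFin _) (∈-allFin _)) (t<h , adjacent d))
  ... | tri≈ _ t≡h _ = contradiction (subst (Adj (tail d)) (sym t≡h) (adjacent d)) irrefl
  ... | tri> _ _ h<t = ∈-++⁺ʳ edges (∈-map⁺ swap
          (∈-filter⁺ (λ (u , v) → (u <ᶠ? v) ×-dec T? (adj u v))
            (∈-cartesianProduct⁺ (∈-allFin _) (∈-allFin _)) (h<t , adj-sym (adjacent d))))

  -- A dart is determined by its ordered ends, and these occur among the listed edges either as they
  -- stand or swapped.
  unique-darts⇒length≤ : ∀ {ds} → Unique ds → length ds ≤ size + size
  unique-darts⇒length≤ {ds} u = begin
    length ds                        ≡⟨ length-map ends ds ⟨
    length (map ends ds)             ≤⟨ unique-⊆⇒length≤ (Unique.map⁺ ends-injective u) sub ⟩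
    length (edges ++ map swap edges) ≡⟨ length-++ edges ⟩
    size + length (map swap edges)   ≡⟨ cong (size +_) (length-map swap edges) ⟩
    size + size                      ∎
    where
    open ℕ.≤-Reasoning
    sub : map ends ds ⊆ edges ++ map swap edges
    sub p∈ with ∈-map⁻ ends p∈
    ... | d , _ , refl = ends∈ d

-- Levels and shortest paths to the root.

-- The laws pin the level down as the distance to `root`: stepping through parents ends at level 0,
-- hence at the root, and `level-≤` forbids shortcuts.
record Levels {n : ℕ} (G : Graph n) (root : Fin n) : Set where
  open Graph G
  field
    level     : Vertex → ℕ
    level-≤   : ∀ {u v} → Adj u v → level u ≤ suc (level v)
    level≡0   : ∀ {v} → level v ≡ 0 → v ≡ root
    parent    : ∀ {v k} → level v ≡ suc k → ∃[ w ] Adj v w × level w ≡ k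

  -- The bound on the levels carries the induction in `geodesic`: a new first vertex lies above all
  -- the others, so it is distinct from them.
  Geodesic : Vertex → ℕ → Set
  Geodesic v k = Σ[ w ∈ Walk v root ]
    ∣ w ∣ʷ ≡ k × Unique (vertices w) × All (λ x → level x ≤ k) (vertices w)

  geodesic : ∀ k {v} → level v ≡ k → Geodesic v k
  geodesic zero lv with level≡0 lv
  ... | refl = ε , refl , [] ∷ [] , ≤-reflexive lv ∷ []
  geodesic (suc k) lv with parent lv
  ... | w , a , lw with geodesic k lw
  ... | p , ∣p∣ , u , ≤k = a ◅ p , cong suc ∣p∣ , All.map v∉ ≤k ∷ u ,
                          ≤-reflexive lv ∷ All.map (λ l → ≤-trans l (n≤1+n k)) ≤k
    where
    v∉ : ∀ {x} → level x ≤ k → _ ≢ x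
    v∉ lx refl = ℕ.<-irrefl refl (subst (_≤ k) lv lx)

  distance≤level : ∀ {v d} → IsDistance v root d → d ≤ level v
  distance≤level (_ , minimal) with geodesic _ refl
  ... | p , ∣p∣ , u , _ = subst (_ ≤_) ∣p∣ (minimal (p , u))

  length-vertices : ∀ {u v} (w : Walk u v) → length (vertices w) ≡ suc ∣ w ∣ʷ
  length-vertices ε       = refl
  length-vertices (_ ◅ w) = cong suc (length-vertices w)

  -- A geodesic from `v` visits `level v + 1` distinct vertices.
  level< : ∀ v → level v < n
  level< v with geodesic _ refl
  ... | p , ∣p∣ , u , _ =
    subst (_≤ n) (trans (length-vertices p) (cong suc ∣p∣)) (unique-vertices⇒length≤ u)

  descent : ∀ l {x k} → level x ≡ l → k < l →
            ∃[ b ] ∃[ a ] Adj b a × level b ≡ suc k × level a ≡ k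
  descent (suc l) {x} {k} lx (s≤s k≤l) with parent lx
  ... | w , a , lw with ℕ.m≤n⇒m<n∨m≡n k≤l
  ... | inj₁ k<l  = descent l lw k<l
  ... | inj₂ refl = x , w , a , lx , lw

-- Construction of the levels in a connected graph.

module _ {n : ℕ} (G : Graph n) (connected : Graph.Connected G) (root : Fin n) where
  open Graph G

  private
    -- The ball of radius `k` around `root`, grown one neighbour at a time so that membership is
    -- decidable by finite search.
    Within : ℕ → Vertex → Set
    Within zero    v = v ≡ root
    Within (suc k) v = Within k v ⊎ ∃[ w ] Adj v w × Within k w

    within? : ∀ k v → Dec (Within k v)
    within? zero    v = v ≟ root
    within? (suc k) v = within? k v ⊎-dec any? (λ w → T? (adj v w) ×-dec within? k w)

    within-walk : ∀ {u v} (w : Walk u v) → v ≡ root → Within ∣ w ∣ʷ u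
    within-walk ε       refl = refl
    within-walk (a ◅ w) eq   = inj₂ (_ , a , within-walk w eq)

    within-mono : ∀ {j k v} → j ≤ k → Within j v → Within k v
    within-mono {zero}  {zero}  _  r = r
    within-mono {zero}  {suc k} _  r = inj₁ (within-mono {zero} {k} z≤n r)
    within-mono {suc j} {suc k} (s≤s j≤k) (inj₁ r) = inj₁ (within-mono j≤k r)
    within-mono {suc j} {suc k} (s≤s j≤k) (inj₂ (w , a , r)) = inj₂ (w , a , within-mono j≤k r)

    least : ∀ k v → Within k v → ∃[ l ] Within l v × (∀ j → Within j v → l ≤ j)
    least zero    v r = zero , r , λ _ _ → z≤n
    least (suc k) v r with within? k v
    ... | yes r′ = least k v r′
    -- The balls are nested, so a vertex outside radius `k` lies outside all smaller ones.
    ... | no ¬r  = suc k , r , λ j rj → ℕ.≰⇒> (λ j≤k → ¬r (within-mono j≤k rj))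

    dist : ∀ v → ∃[ l ] Within l v × (∀ j → Within j v → l ≤ j)
    dist v = least _ v (within-walk (proj₁ (proj₂ connected v root)) refl)

    level : Vertex → ℕ
    level v = proj₁ (dist v)

    within-level : ∀ v → Within (level v) v
    within-level v = proj₁ (proj₂ (dist v))

    level-minimal : ∀ v j → Within j v → level v ≤ j
    level-minimal v = proj₂ (proj₂ (dist v))

    level-≤ : ∀ {u v} → Adj u v → level u ≤ suc (level v)
    level-≤ {u} {v} a = level-minimal u _ (inj₂ (v , a , within-level v))

    parent : ∀ {v k} → level v ≡ suc k → ∃[ w ] Adj v w × level w ≡ k
    parent {v} {k} lv with subst (λ l → Within l v) lv (within-level v)
    ... | inj₁ r = contradiction (subst (_≤ k) lv (level-minimal v k r)) ℕ.1+n≰n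
    ... | inj₂ (w , a , r) = w , a ,
      ≤-antisym (level-minimal w k r) (s≤s⁻¹ (subst (_≤ suc (level w)) lv (level-≤ a)))

  levels : Levels G root
  levels = record
    { level   = level
    ; level-≤ = level-≤
    ; level≡0 = λ {v} l0 → subst (λ l → Within l v) l0 (within-level v)
    ; parent  = parent
    }

-- Faces whose darts are all marked except a highest and a lowest one.

-- Exchanging "above" and "below" gives a bounce again (see dual), which is why heights
-- are compared through the abstract relations _⋖_ (one step below) and _≼_.
record Bounce {n : ℕ} (G : Graph n) (next prev : Graph.Dart G → Graph.Dart G)
              (OnFace Marked : Graph.Dart G → Set) : Set₁ where
  open Graph G
  infix 4 _⋖_ _≼_
  field
    height  : Vertex → ℕ
    _⋖_ _≼_ : ℕ → ℕ → Set
    ⋖-asym  : ∀ {a b} → a ⋖ b → ¬ b ⋖ a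
    ⋖-injˡ  : ∀ {a b c} → a ⋖ c → b ⋖ c → a ≡ b
    ⋖-injʳ  : ∀ {a b c} → c ⋖ a → c ⋖ b → a ≡ b
    ⋖⇒⋡     : ∀ {a b} → a ⋖ b → ¬ b ≼ a

  Up : Dart → Set
  Up d = height (tail d) ⋖ height (head d)

  Down : Dart → Set
  Down d = height (head d) ⋖ height (tail d)

  Flat : Dart → Set
  Flat d = height (tail d) ≡ height (head d)

  field
    direction   : ∀ d → Up d ⊎ Flat d ⊎ Down d
    next-prev   : ∀ d → next (prev d) ≡ d
    tail-next   : ∀ d → tail (next d) ≡ head d
    on-next     : ∀ {d} → OnFace d → OnFace (next d)
    on-prev     : ∀ {d} → OnFace d → OnFace (prev d)
    marked      : ∀ {d} → Marked d → (Up d × Up (next d)) ⊎ (Down d × Down (next d))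
    marked-thin : ∀ {d e} → Marked d → Marked e → Up d → Down e →
                  height (head d) ≡ height (head e) → head d ≡ head e
    top bottom  : Dart
    on-top      : OnFace top
    on-bottom   : OnFace bottom
    max         : ∀ {d} → OnFace d → height (head d) ≼ height (head top)
    min         : ∀ {d} → OnFace d → height (head bottom) ≼ height (head d)
    top≢bottom  : height (head top) ≢ height (head bottom)
    cover       : ∀ {d} → OnFace d → Marked d ⊎ d ≡ top ⊎ d ≡ bottom

dual : ∀ {n} {G : Graph n} {next prev OnFace Marked} →
       Bounce G next prev OnFace Marked → Bounce G next prev OnFace Marked
dual B = record
  { height = height ; _⋖_ = λ a b → b ⋖ a ; _≼_ = λ a b → b ≼ a
  ; ⋖-asym = ⋖-asym ; ⋖-injˡ = ⋖-injʳ ; ⋖-injʳ = ⋖-injˡ ; ⋖⇒⋡ = ⋖⇒⋡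
  ; direction = λ d → exchange (direction d)
  ; next-prev = next-prev ; tail-next = tail-next ; on-next = on-next ; on-prev = on-prev
  ; marked = λ m → Sum.swap (marked m)
  ; marked-thin = λ md me down up eq → sym (marked-thin me md up down (sym eq))
  ; top = bottom ; bottom = top ; on-top = on-bottom ; on-bottom = on-top
  ; max = min ; min = max ; top≢bottom = top≢bottom ∘ sym
  ; cover = λ o → Sum.map₂ Sum.swap (cover o)
  }
  where
  open Bounce B
  exchange : {A B C : Set} → A ⊎ B ⊎ C → C ⊎ B ⊎ A
  exchange (inj₁ a)        = inj₂ (inj₂ a)
  exchange (inj₂ (inj₁ b)) = inj₂ (inj₁ b)
  exchange (inj₂ (inj₂ c)) = inj₁ c

module BounceProperties {n : ℕ} {G : Graph n} {next prev : Graph.Dart G → Graph.Dart G}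
                        {OnFace Marked : Graph.Dart G → Set}
                        (B : Bounce G next prev OnFace Marked) where
  open Graph G renaming (sym to adj-sym)
  open DartCount G using (dart-≡; rev-involutive; loopless)
  open Bounce B

  head-prev : ∀ d → head (prev d) ≡ tail d
  head-prev d = trans (sym (tail-next (prev d))) (cong tail (next-prev d))

  ⋖-irrefl : ∀ {a b} → a ≡ b → ¬ a ⋖ b
  ⋖-irrefl refl p = ⋖-asym p p

  tail≼top : ∀ {d} → OnFace d → height (tail d) ≼ height (head top)
  tail≼top {d} o = subst (λ v → height v ≼ _) (head-prev d) (max (on-prev o))

  bottom≼tail : ∀ {d} → OnFace d → height (head bottom) ≼ height (tail d)
  bottom≼tail {d} o = subst (λ v → _ ≼ height v) (head-prev d) (min (on-prev o))

  next-down : ∀ {d} → Marked d → Down d → Down (next d)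
  next-down m down with marked m
  ... | inj₁ (up , _)   = contradiction down (⋖-asym up)
  ... | inj₂ (_ , down′) = down′

  up-before-up : ∀ {d} → Marked d → Up (next d) → Up d
  up-before-up m up with marked m
  ... | inj₁ (up′ , _)  = up′
  ... | inj₂ (_ , down) = contradiction down (⋖-asym up)

  up-next : ∀ {d e} → head d ≡ head e → Up (next e) → height (head d) ⋖ height (head (next e))
  up-next {d} {e} eq = subst (λ v → height v ⋖ _) (trans (tail-next e) (sym eq))

  up-next≢top : ∀ {d} → Up (next d) → OnFace d → d ≢ top
  up-next≢top {d} up o refl = ⋖⇒⋡ (up-next {d} {d} refl up) (max (on-next o))

  down≢top : ∀ {d} → Down d → OnFace d → d ≢ top
  down≢top down o refl = ⋖⇒⋡ down (tail≼top o)

  down-next≢bottom : ∀ {d} → Down (next d) → OnFace d → height (head d) ≢ height (head bottom)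
  down-next≢bottom {d} down o eq =
    ⋖⇒⋡ (subst (height (head (next d)) ⋖_) (trans (cong height (tail-next d)) eq) down)
        (min (on-next o))

  up≢bottom : ∀ {d} → Up d → OnFace d → height (head d) ≢ height (head bottom)
  up≢bottom {d} up o eq = ⋖⇒⋡ (subst (height (tail d) ⋖_) eq up) (bottom≼tail o)

  -- Two marked darts agree by `marked-thin`. Neither dart is `top`, which is not descending and is
  -- not followed by a rise. If just one of them is `bottom`, the other is marked and would take the
  -- face below its minimum.
  meet : ∀ {x w} → OnFace x → Down x → OnFace w → Up (next w) →
         height (head x) ≡ height (head w) → head x ≡ head w
  meet {x} {w} ox down ow up eq with cover ox | cover ow
  ... | inj₂ (inj₁ x≡top) | _                 = contradiction x≡top (down≢top down ox)
  ... | _                 | inj₂ (inj₁ w≡top) = contradiction w≡top (up-next≢top up ow)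
  ... | inj₁ mx | inj₁ mw = sym (marked-thin mw mx (up-before-up mw up) down (sym eq))
  ... | inj₁ mx | inj₂ (inj₂ refl) = contradiction eq (down-next≢bottom (next-down mx down) ox)
  ... | inj₂ (inj₂ refl) | inj₁ mw = contradiction (sym eq) (up≢bottom (up-before-up mw up) ow)
  ... | inj₂ (inj₂ refl) | inj₂ (inj₂ refl) = refl

  -- The dart `prev (rev x)` ends where `x` ends. If `x` is `bottom`, the two coincide and the face
  -- turns back there. Otherwise both darts continue the same vertical run, `meet` identifies their
  -- lower ends, and `prev (rev x)` is the reverse of `next x`.
  next-of-reversible-down : ∀ {x} → OnFace x → OnFace (rev x) → Down x → OnFace (rev (next x))
  next-of-reversible-down {x} ox oy down with cover ox
  ... | inj₂ (inj₁ x≡top) = contradiction x≡top (down≢top down ox)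
  ... | inj₂ (inj₂ refl) = subst OnFace (sym (trans (cong rev next-x) (rev-involutive x))) ox
    where
    y′ = prev (rev x)
    up : Up (next y′)
    up = subst Up (sym (next-prev (rev x))) down
    y′≡x : y′ ≡ x
    y′≡x with cover (on-prev oy)
    ... | inj₁ m = contradiction (cong height (head-prev (rev x))) (up≢bottom (up-before-up m up) (on-prev oy))
    ... | inj₂ (inj₁ y′≡top) = contradiction y′≡top (up-next≢top up (on-prev oy))
    ... | inj₂ (inj₂ y′≡bottom) = y′≡bottom
    next-x : next x ≡ rev x
    next-x = trans (cong next (sym y′≡x)) (next-prev (rev x))
  ... | inj₁ m = subst OnFace (dart-≡ tails heads) (on-prev oy)
    where
    y′ = prev (rev x)
    oy′ = on-prev oy
    head-y′ : head y′ ≡ head x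
    head-y′ = head-prev (rev x)
    up : Up (next y′)
    up = subst Up (sym (next-prev (rev x))) down
    down′ : Down (next x)
    down′ = next-down m down
    up′ : Up y′
    up′ with cover oy′
    ... | inj₁ m′ = up-before-up m′ up
    ... | inj₂ (inj₁ y′≡top) = contradiction y′≡top (up-next≢top up oy′)
    ... | inj₂ (inj₂ y′≡bottom) = contradiction
      (cong height (trans (sym head-y′) (cong head y′≡bottom))) (down-next≢bottom down′ ox)
    below : ∀ {d e} → Down d → Up e → tail d ≡ head e → height (head d) ≡ height (tail e)
    below {e = e} down up eq =
      ⋖-injˡ down (subst (λ v → height (tail e) ⋖ height v) (sym eq) up)
    tails : tail y′ ≡ head (next x)
    tails = sym (trans (meet (on-next ox) down′ (on-prev oy′) (subst Up (sym (next-prev y′)) up′)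
                  (trans (below {next x} {y′} down′ up′ (trans (tail-next x) (sym head-y′)))
                         (cong height (sym (head-prev y′)))))
                (head-prev y′))
    heads : head y′ ≡ tail (next x)
    heads = trans head-y′ (sym (tail-next x))

  ¬marked-before-flat : ∀ {d} → Marked d → ¬ Flat (next d)
  ¬marked-before-flat m eq with marked m
  ... | inj₁ (_ , up)   = ⋖-irrefl eq up
  ... | inj₂ (_ , down) = ⋖-irrefl (sym eq) down

  -- A flat `top` needs an unmarked predecessor, because a marked dart is followed by a vertical
  -- one. That predecessor is not `top`, which is no loop, nor `bottom`, which ends at another
  -- height.
  up-top : Up top
  up-top with direction top
  ... | inj₁ up = up
  ... | inj₂ (inj₂ down) = contradiction refl (down≢top down on-top)
  ... | inj₂ (inj₁ flat) with cover (on-prev on-top)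
  ... | inj₁ m = contradiction (subst Flat (sym (next-prev top)) flat) (¬marked-before-flat m)
  ... | inj₂ (inj₁ eq) = contradiction (trans (sym (head-prev top)) (cong head eq)) (loopless top)
  ... | inj₂ (inj₂ eq) = contradiction
    (trans (sym flat) (cong height (trans (sym (head-prev top)) (cong head eq)))) top≢bottom

module _ {n : ℕ} {G : Graph n} {next prev : Graph.Dart G → Graph.Dart G}
         {OnFace Marked : Graph.Dart G → Set} (B : Bounce G next prev OnFace Marked) where
  open Graph G renaming (sym to adj-sym)
  open DartCount G using (dart-≡; rev-involutive)
  open Bounce B
  open BounceProperties B
  private module Dual = BounceProperties (dual B)

  vertical : ∀ {d} → OnFace d → Up d ⊎ Down d
  vertical o with cover o
  ... | inj₂ (inj₁ refl) = inj₁ up-top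
  -- In the dual, `bottom` is the top and descending is rising.
  ... | inj₂ (inj₂ refl) = inj₂ Dual.up-top
  ... | inj₁ m with marked m
  ... | inj₁ (up , _)   = inj₁ up
  ... | inj₂ (down , _) = inj₂ down

  down-after-top : Down (next top)
  down-after-top with vertical (on-next on-top)
  ... | inj₁ up   = contradiction refl (up-next≢top up on-top)
  ... | inj₂ down = down

  -- By `meet`, the descent after `top` ends at the vertex from which `top` rises, so the face turns
  -- back along the same edge.
  rev-top : rev top ≡ next top
  rev-top = dart-≡ (sym (tail-next top)) (sym
    (trans (meet (on-next on-top) down-after-top (on-prev on-top)
             (subst Up (sym (next-prev top)) up-top)
             (trans (⋖-injˡ down-after-top (subst (λ v → _ ⋖ height v) (sym (tail-next top)) up-top))
                    (cong height (sym (head-prev top)))))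
           (head-prev top)))

  -- The invariant that a dart and its reverse are both on the face holds at `top` and is carried
  -- along `next`, directly on descents and by duality on rises.
  bounce-reversible : (∀ {d} → OnFace d → ∃[ k ] iterate next top k ≡ d) →
                      ∀ {d} → OnFace d → OnFace (rev d)
  bounce-reversible orbit o with orbit o
  ... | k , refl = proj₂ (iterate-preserves (λ d → OnFace d × OnFace (rev d)) step k
                     (on-top , subst OnFace (sym rev-top) (on-next on-top)))
    where
    step : ∀ {d} → OnFace d × OnFace (rev d) → OnFace (next d) × OnFace (rev (next d))
    step (o , r) with vertical o
    ... | inj₁ up   = on-next o , Dual.next-of-reversible-down o r up
    ... | inj₂ down = on-next o , next-of-reversible-down o r down

-- Rises and falls in the rotation around a vertex.

module Corners {n : ℕ} (G : Graph n) {root : Fin n} (L : Levels G root)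
               (R : RotationSystem G) where
  open Graph G renaming (sym to adj-sym)
  open DartCount G
  open Levels L
  open RotationSystem R renaming (nextOnFace to next) public

  rot unrot prev : Dart → Dart
  rot   = Inverse.to rotation
  unrot = Inverse.from rotation
  prev d = rev (unrot d)

  next-prev : ∀ d → next (prev d) ≡ d
  next-prev d = trans (cong rot (rev-involutive (unrot d))) (Inverse.strictlyInverseˡ rotation d)

  prev-next : ∀ d → prev (next d) ≡ d
  prev-next d = trans (cong rev (Inverse.strictlyInverseʳ rotation (rev d))) (rev-involutive d)

  next-injective : ∀ {d e} → next d ≡ next e → d ≡ e
  next-injective {d} {e} eq = trans (sym (prev-next d)) (trans (cong prev eq) (prev-next e))

  tail-rot : ∀ d → tail (rot d) ≡ tail d
  tail-rot d = sym (Equivalence.to (cyclic d (rot d)) (1 , refl))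

  tail-next : ∀ d → tail (next d) ≡ head d
  tail-next d = tail-rot (rev d)

  turn : ∀ d e → tail d ≡ tail e → ∃[ k ] iterate rot d k ≡ e
  turn d e = Equivalence.from (cyclic d e)

  Rise Fall Flat : Dart → Set
  Rise d = level (head d) ≡ suc (level (tail d))
  Fall d = level (tail d) ≡ suc (level (head d))
  Flat d = level (tail d) ≡ level (head d)

  ¬rise∧fall : ∀ d → Rise d → ¬ Fall d
  ¬rise∧fall _ r f = ℕ.<-asym (≤-reflexive (sym r)) (≤-reflexive (sym f))

  ¬rise∧flat : ∀ d → Rise d → ¬ Flat d
  ¬rise∧flat _ r e = ℕ.1+n≢n (trans (sym r) (sym e))

  ¬fall∧flat : ∀ d → Fall d → ¬ Flat d
  ¬fall∧flat _ f e = ℕ.1+n≢n (trans (sym f) e)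

  slope : ∀ d → Rise d ⊎ Flat d ⊎ Fall d
  slope d with ℕ.<-cmp (level (tail d)) (level (head d))
  ... | tri< t<h _ _ = inj₁ (≤-antisym (level-≤ (adj-sym (adjacent d))) t<h)
  ... | tri≈ _ t≡h _ = inj₂ (inj₁ t≡h)
  ... | tri> _ _ h<t = inj₂ (inj₂ (≤-antisym (level-≤ (adjacent d)) h<t))

  DoubleRise DoubleFall : Dart → Set
  DoubleRise d = Rise d × Rise (next d)
  DoubleFall d = Fall d × Fall (next d)

  module _ {a : Vertex} {d₋ d₊ : Dart} (t₋ : tail d₋ ≡ a) (t₊ : tail d₊ ≡ a)
           (f₋ : Fall d₋) (r₊ : Rise d₊) where

    private
      At : (Dart → Set) → Dart → Set
      At P d = tail d ≡ a × P d

      at-rot : ∀ d → tail d ≡ a → tail (rot d) ≡ a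
      at-rot d t = trans (tail-rot d) t

      slope-at : ∀ d → tail d ≡ a → At Fall d ⊎ At Flat d ⊎ At Rise d
      slope-at d t with slope d
      ... | inj₁ r        = inj₂ (inj₂ (t , r))
      ... | inj₂ (inj₁ e) = inj₂ (inj₁ (t , e))
      ... | inj₂ (inj₂ f) = inj₁ (t , f)

      swap₁₃ : {A B C : Set} → A ⊎ B ⊎ C → C ⊎ B ⊎ A
      swap₁₃ (inj₁ x)        = inj₂ (inj₂ x)
      swap₁₃ (inj₂ (inj₁ x)) = inj₂ (inj₁ x)
      swap₁₃ (inj₂ (inj₂ x)) = inj₁ x

      next-rev : ∀ d → next (rev d) ≡ rot d
      next-rev d = cong rot (rev-involutive d)

    -- Turning from `d₋` to `d₊`, some falling dart `y` is followed at once by a rising one. Then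
    -- `rev y` rises into `a`, and its successor on the face is `rot y`, which rises further.
    doubleRise : (∀ z → At Flat z → Fall (rot z)) → ∃[ e ] head e ≡ a × DoubleRise e
    doubleRise after-flat with turn d₋ d₊ (trans t₋ (sym t₊))
    ... | k , eq with direct-transition rot {At Fall} {At Flat} {At Rise}
                        (λ {x} (_ , f) (_ , r) → ¬rise∧fall x r f)
                        (λ {x} (_ , e) (_ , r) → ¬rise∧flat x r e)
                        (λ {x} (t , _) → slope-at (rot x) (at-rot x t))
                        (λ {x} (t , e) → at-rot x t , after-flat x (t , e))
                        k (inj₁ (t₋ , f₋)) (subst (At Rise) (sym eq) (t₊ , r₊))
    ... | y , (t , f) , (_ , r) = rev y , t , f , subst Rise (sym (next-rev y)) r

    doubleFall : (∀ z → At Flat z → Rise (rot z)) → ∃[ e ] head e ≡ a × DoubleFall e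
    doubleFall after-flat with turn d₊ d₋ (trans t₊ (sym t₋))
    ... | k , eq with direct-transition rot {At Rise} {At Flat} {At Fall}
                        (λ {x} (_ , r) (_ , f) → ¬rise∧fall x r f)
                        (λ {x} (_ , e) (_ , f) → ¬fall∧flat x f e)
                        (λ {x} (t , _) → swap₁₃ (slope-at (rot x) (at-rot x t)))
                        (λ {x} (t , e) → at-rot x t , after-flat x (t , e))
                        k (inj₁ (t₊ , r₊)) (subst (At Fall) (sym eq) (t₋ , f₋))
    ... | y , (t , r) , (_ , f) = rev y , t , r , subst Fall (sym (next-rev y)) f

    -- The dart that follows the only flat one decides: if it falls, no flat dart separates a fall
    -- from the next rise; if it rises, none separates a rise from the next fall.
    doubleRiseOrFall : (∀ z z′ → At Flat z → At Flat z′ → z ≡ z′) →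
                       ∃[ e ] head e ≡ a × (DoubleRise e ⊎ DoubleFall e)
    doubleRiseOrFall unique with any? (λ v → T? (adj a v) ×-dec (level a ℕ.≟ level v))
    ... | no ¬flat with doubleRise (λ z (t , e) →
                         contradiction (head z , subst (λ v → Adj v (head z)) t (adjacent z)
                                               , subst (λ v → level v ≡ level (head z)) t e) ¬flat)
    ... | e , h , r = e , h , inj₁ r
    doubleRiseOrFall unique | yes (v , adj , flat) with slope-at (rot (dart adj)) (at-rot (dart adj) refl)
    ... | inj₁ (_ , f) with doubleRise (λ z at → subst (Fall ∘ rot) (unique _ z (refl , flat) at) f)
    ... | e , h , r = e , h , inj₁ r
    doubleRiseOrFall unique | yes (v , adj , flat) | inj₂ (inj₂ (_ , r))
      with doubleFall (λ z at → subst (Rise ∘ rot) (unique _ z (refl , flat) at) r)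
    ... | e , h , f = e , h , inj₂ f
    -- A flat successor is the flat dart itself; the rotation would fix it and never reach `d₋`.
    doubleRiseOrFall unique | yes (v , adj , flat) | inj₂ (inj₁ at) with turn (dart adj) d₋ (sym t₋)
    ... | k , eq = contradiction (subst Flat (trans (sym fixed) eq) flat) (¬fall∧flat d₋ f₋)
      where
      fixed : iterate rot (dart adj) k ≡ dart adj
      fixed = iterate-preserves (_≡ dart adj)
                (λ { refl → unique _ _ at (refl , flat) }) k refl

  -- The marks at a single level.

  stratum : ℕ → List Vertex
  stratum k = filter (λ v → level v ℕ.≟ k) (allFin n)

  ∈-stratum⁺ : ∀ {v k} → level v ≡ k → v ∈ stratum k
  ∈-stratum⁺ {v} = ∈-filter⁺ (λ v → level v ℕ.≟ _) (∈-allFin v)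

  ∈-stratum⁻ : ∀ {v k} → v ∈ stratum k → level v ≡ k
  ∈-stratum⁻ {k = k} v∈ = proj₂ (∈-filter⁻ (λ v → level v ℕ.≟ k) {xs = allFin n} v∈)

  stratum-unique : ∀ k → Unique (stratum k)
  stratum-unique k = Unique.filter⁺ (λ v → level v ℕ.≟ k) (allFin⁺ n)

  -- The marks that pay for the excess of level `k`. The field `thin` later lets a descent and a
  -- climb of one face be identified at this level.
  record Crossings (k : ℕ) : Set where
    field
      crossings : List Dart
      unique    : Unique crossings
      at-level  : ∀ {d} → d ∈ crossings → level (head d) ≡ k
      double    : ∀ {d} → d ∈ crossings → DoubleRise d ⊎ DoubleFall d
      thin      : ∀ {d e} → d ∈ crossings → e ∈ crossings → Rise d → Fall e → head d ≡ head e
      enough    : 3 ≤ length (stratum k) + length crossings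

  -- A vertex alone on its level has no flat dart, so both a climb and a descent pass through it.
  -- With one companion it has at most one flat dart, which leaves one of the two. Three vertices
  -- already suffice without marks.
  crossings-at : ∀ {k b a c} → level b ≡ suc (suc k) → level a ≡ suc k → level c ≡ k →
                 Adj a b → Adj a c → Crossings (suc k)
  crossings-at {k} {b} {a} {c} lb la lc ab ac = by-size (stratum (suc k)) refl
    where
    fall : Fall (dart ac)
    fall = trans la (cong suc (sym lc))
    rise : Rise (dart ab)
    rise = trans lb (cong suc (sym la))

    AtFlat : Dart → Set
    AtFlat z = tail z ≡ a × Flat z

    head≢ : ∀ z → AtFlat z → head z ≢ a
    head≢ z (t , _) h = irrefl (subst₂ Adj t h (adjacent z))

    module _ {vs : List Vertex} (stratum≡ : stratum (suc k) ≡ vs) where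
      ∈vs : ∀ {v} → level v ≡ suc k → v ∈ vs
      ∈vs lv = subst (_ ∈_) stratum≡ (∈-stratum⁺ lv)

      head∈ : ∀ z → AtFlat z → head z ∈ vs
      head∈ z (t , e) = ∈vs (trans (sym e) (trans (cong level t) la))

    by-size : ∀ vs → stratum (suc k) ≡ vs → Crossings (suc k)
    by-size [] eq with () ← ∈vs eq la
    by-size (x ∷ []) eq = record
      { crossings = r ∷ f ∷ []
      ; unique    = (r≢f ∷ []) ∷ [] ∷ []
      ; at-level  = at
      ; double    = λ { (here refl) → inj₁ rr ; (there (here refl)) → inj₂ ff }
      ; thin      = λ d∈ e∈ _ _ → only (at d∈) (at e∈)
      ; enough    = subst (λ vs → 3 ≤ length vs + 2) (sym eq) ≤-refl
      }
      where
      only : ∀ {u v} → level u ≡ suc k → level v ≡ suc k → u ≡ v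
      only lu lv with ∈vs eq lu | ∈vs eq lv
      ... | here refl | here refl = refl
      none : ∀ z → ¬ AtFlat z
      none z at@(t , e) = head≢ z at (only (trans (sym e) (trans (cong level t) la)) la)
      up = doubleRise {d₋ = dart ac} {dart ab} refl refl fall rise (λ z at → contradiction at (none z))
      down = doubleFall {d₋ = dart ac} {dart ab} refl refl fall rise (λ z at → contradiction at (none z))
      r = proj₁ up
      f = proj₁ down
      rr = proj₂ (proj₂ up)
      ff = proj₂ (proj₂ down)
      r≢f : r ≢ f
      r≢f eq = ¬rise∧fall r (proj₁ rr) (subst Fall (sym eq) (proj₁ ff))
      at : ∀ {d} → d ∈ r ∷ f ∷ [] → level (head d) ≡ suc k
      at (here refl)         = trans (cong level (proj₁ (proj₂ up))) la
      at (there (here refl)) = trans (cong level (proj₁ (proj₂ down))) la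
    by-size (x ∷ y ∷ []) eq
      with doubleRiseOrFall {d₋ = dart ac} {dart ab} refl refl fall rise same
      where
      -- A flat dart at `a` must lead to the other vertex of the level, which determines it.
      same : ∀ z z′ → AtFlat z → AtFlat z′ → z ≡ z′
      same z z′ p q with ∈vs eq la | head∈ eq z p | head∈ eq z′ q
      ... | here refl | here h | _ = contradiction h (head≢ z p)
      ... | here refl | _ | here h = contradiction h (head≢ z′ q)
      ... | there (here refl) | there (here h) | _ = contradiction h (head≢ z p)
      ... | there (here refl) | _ | there (here h) = contradiction h (head≢ z′ q)
      ... | here _ | there (here h) | there (here h′) =
        dart-≡ (trans (proj₁ p) (sym (proj₁ q))) (trans h (sym h′))
      ... | there _ | here h | here h′ =
        dart-≡ (trans (proj₁ p) (sym (proj₁ q))) (trans h (sym h′))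
    ... | e , h , rf = record
      { crossings = e ∷ []
      ; unique    = [] ∷ []
      ; at-level  = λ { (here refl) → trans (cong level h) la }
      ; double    = λ { (here refl) → rf }
      ; thin      = λ { (here refl) (here refl) _ _ → refl }
      ; enough    = subst (λ vs → 3 ≤ length vs + 1) (sym eq) ≤-refl
      }
    by-size (x ∷ y ∷ z ∷ vs) eq = record
      { crossings = []
      ; unique    = []
      ; at-level  = λ ()
      ; double    = λ ()
      ; thin      = λ ()
      ; enough    = subst (λ vs → 3 ≤ length vs + 0) (sym eq) (s≤s (s≤s (s≤s z≤n)))
      }

  -- Going down from `v` through parents passes a vertex of level `suc k` with neighbours on both
  -- adjacent levels.
  crossings-below : ∀ {v k} → suc k < level v → Crossings (suc k)
  crossings-below k<l with descent _ refl k<l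
  ... | b , a , ba , lb , la with parent la
  ... | c , ac , lc = crossings-at lb la lc (adj-sym ba) ac

-- Marked and unmarked darts on the faces.

module Faces {n : ℕ} (G : Graph n) (connected : Graph.Connected G) {root : Fin n}
             (L : Levels G root) (R : RotationSystem G) (far : Fin n) {F : ℕ}
             (faces : HasClasses (SameCycle (RotationSystem.nextOnFace R)) F) where
  open Graph G renaming (sym to adj-sym)
  open DartCount G
  open Levels L
  open Corners G L R
  open HasClasses faces
  open import Data.List.Membership.DecPropositional _≟ᵈ_ using (_∈?_)

  private
    -- The number of levels strictly between 0 and that of `far`; index `i` stands for level
    -- `i + 1`.
    M = pred (level far)

    below-far : (i : Fin M) → suc (toℕ i) < level far
    below-far i = lemma (level far) (toℕ<n i)
      where
      lemma : ∀ l {k} → k < pred l → suc k < l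
      lemma (suc l) k<l = s≤s k<l

    module C (i : Fin M) = Crossings (crossings-below {far} (below-far i))

  marks : List Dart
  marks = concatMap C.crossings (allFin M)

  private
    same-level : ∀ {i j d e} → d ∈ C.crossings i → e ∈ C.crossings j →
                 level (head d) ≡ level (head e) → i ≡ j
    same-level {i} {j} d∈ e∈ eq =
      toℕ-injective (ℕ.suc-injective (trans (sym (C.at-level i d∈)) (trans eq (C.at-level j e∈))))

  marks-unique : Unique marks
  marks-unique =
    concatMap-unique C.crossings (λ p q → same-level p q refl) C.unique (allFin⁺ M)

  marks-double : ∀ {d} → d ∈ marks → DoubleRise d ⊎ DoubleFall d
  marks-double d∈ with ∈-concatMap⁻′ C.crossings {allFin M} d∈
  ... | i , d∈i = C.double i d∈i

  marks-thin : ∀ {d e} → d ∈ marks → e ∈ marks → Rise d → Fall e →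
               level (head d) ≡ level (head e) → head d ≡ head e
  marks-thin d∈ e∈ r f eq
    with ∈-concatMap⁻′ C.crossings {allFin M} d∈ | ∈-concatMap⁻′ C.crossings {allFin M} e∈
  ... | i , d∈i | j , e∈j with same-level d∈i e∈j eq
  ... | refl = C.thin i d∈i e∈j r f

  -- Each of the `M` inner levels contributes at least three vertices and marks. For positive
  -- `level far`, the two ends are further vertices, and the `suc` completes the last three.
  marks-enough : level far * 3 ≤ suc (n + length marks)
  marks-enough = bound (level far) refl
    where
    middle : List Vertex
    middle = concatMap (λ i → stratum (suc (toℕ i))) (allFin M)

    middle-unique : Unique middle
    middle-unique = concatMap-unique (λ i → stratum (suc (toℕ i)))
      (λ {i} {j} p q → toℕ-injective (ℕ.suc-injective (trans (sym (∈-stratum⁻ p)) (∈-stratum⁻ q))))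
      (λ i → stratum-unique (suc (toℕ i))) (allFin⁺ M)

    middle-level : ∀ {v} → v ∈ middle → ∃[ i ] level v ≡ suc (toℕ {M} i)
    middle-level v∈ with ∈-concatMap⁻′ (λ i → stratum (suc (toℕ i))) {allFin M} v∈
    ... | i , v∈i = i , ∈-stratum⁻ v∈i

    shift : ∀ m s x → m * 3 ≤ x + s → suc m * 3 ≤ suc (2 + x + s)
    shift m s x p = s≤s (s≤s (s≤s p))

    bound : ∀ l → level far ≡ l → l * 3 ≤ suc (n + length marks)
    bound zero    _   = z≤n
    bound (suc m) eq = ≤-trans (shift m _ (length middle) enough)
        (s≤s (ℕ.+-monoˡ-≤ (length marks) (unique-vertices⇒length≤ ends-unique)))
      where
      M≡m : M ≡ m
      M≡m = cong pred eq

      enough : m * 3 ≤ length middle + length marks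
      enough = subst (λ k → k * 3 ≤ _) (trans (length-allFin M) M≡m)
        (length-concatMap₂-≥ (λ i → stratum (suc (toℕ i))) C.crossings C.enough (allFin M))

      -- Descending from a root of positive level would end at level 0, hence at the root again.
      level-root : ∀ {v l} → level v ≡ suc l → v ≢ root
      level-root lv refl with descent _ lv (s≤s z≤n)
      ... | b , a , ba , lb , la with level≡0 la
      ... | refl with () ← trans (sym lv) la

      ends-unique : Unique (root ∷ far ∷ middle)
      ends-unique =
        ((λ r≡f → level-root eq (sym r≡f)) ∷ All.tabulate (λ v∈ r≡v →
           level-root (proj₂ (middle-level v∈)) (sym r≡v)))
        ∷ All.tabulate (λ { v∈ refl → ℕ.<-irrefl (sym (proj₂ (middle-level v∈)))
                                        (below-far (proj₁ (middle-level v∈))) })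
        ∷ middle-unique

  class-next : ∀ d → class (next d) ≡ class d
  class-next d = sym (Equivalence.to (classifies d (next d)) (1 , refl))

  class-prev : ∀ d → class (prev d) ≡ class d
  class-prev d = trans (sym (class-next (prev d))) (cong class (next-prev d))

  orbit : ∀ {d e} → class d ≡ class e → ∃[ k ] iterate next d k ≡ e
  orbit {d} {e} = Equivalence.from (classifies d e)

  -- Such a face is closed under rotation, hence contains every dart.
  reversible⇒all : ∀ {c d₀} → class d₀ ≡ c → (∀ {d} → class d ≡ c → class (rev d) ≡ c) →
                   ∀ d → class d ≡ c
  reversible⇒all {c} {d₀} on-d₀ on-rev d =
    spread (proj₁ (proj₂ connected (tail d₀) (tail d))) (around on-d₀) refl
    where
    Full : Vertex → Set
    Full v = ∀ {e} → tail e ≡ v → class e ≡ c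

    on-rot : ∀ {e} → class e ≡ c → class (rot e) ≡ c
    on-rot {e} on = trans (cong class (cong rot (sym (rev-involutive e))))
                          (trans (class-next (rev e)) (on-rev on))

    around : ∀ {e} → class e ≡ c → Full (tail e)
    around {e} on {e′} t with turn e e′ (sym t)
    ... | k , refl = iterate-preserves (λ x → class x ≡ c) on-rot k on

    spread : ∀ {u v} → Walk u v → Full u → Full v
    spread ε       full = full
    spread (a ◅ w) full = spread w (around (on-rev (full {dart a} refl)))

  -- The charge of one face. Such darts differ from face to face and from all marks, so everything
  -- fits in one list of distinct darts.
  record Free (c : Fin F) : Set where
    field
      free       : List Dart
      unique     : Unique free
      length≡3   : length free ≡ 3
      free-class : ∀ {d} → d ∈ free → class d ≡ c
      unmarked   : ∀ {d} → d ∈ free → d ∉ marks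

  three : ∀ {c x y z} → x ≢ y → x ≢ z → y ≢ z → class x ≡ c → class y ≡ c → class z ≡ c →
          x ∉ marks → y ∉ marks → z ∉ marks → Free c
  three {c} {x} {y} {z} x≢y x≢z y≢z cx cy cz x∉ y∉ z∉ = record
    { free       = x ∷ y ∷ z ∷ []
    ; unique     = (x≢y ∷ x≢z ∷ []) ∷ (y≢z ∷ []) ∷ [] ∷ []
    ; length≡3   = refl
    ; free-class = λ { (here refl) → cx ; (there (here refl)) → cy ; (there (there (here refl))) → cz }
    ; unmarked   = λ { (here refl) → x∉ ; (there (here refl)) → y∉ ; (there (there (here refl))) → z∉ }
    }

  head-prev : ∀ d → head (prev d) ≡ tail d
  head-prev d = trans (sym (tail-next (prev d))) (cong tail (next-prev d))

  next-loopless : ∀ d → next d ≢ d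
  next-loopless d eq = loopless d (trans (sym (cong tail eq)) (tail-next d))

  -- The darts with highest and lowest heads are unmarked. If the heights differ, a third unmarked
  -- dart gives `Free`; without one the face is a bounce, hence closed under reversal. If they
  -- agree, the whole face is flat and carries no marks.
  free-or-all : ∀ {c d₀} → class d₀ ≡ c → Free c ⊎ (∀ d → class d ≡ c)
  free-or-all {c} {d₀} on-d₀ = by-height (level (head top) ℕ.≟ level (head bottom))
    where
    face : List Dart
    face = filter (λ d → class d ≟ c) darts

    ∈-face : ∀ {d} → class d ≡ c → d ∈ face
    ∈-face {d} = ∈-filter⁺ (λ d → class d ≟ c) (∈-darts d)

    face-on : All (λ d → class d ≡ c) face
    face-on = All.tabulate (λ d∈ → proj₂ (∈-filter⁻ (λ d → class d ≟ c) {xs = darts} d∈))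

    top bottom : Dart
    -- The default `d₀` is itself on the face, so both extremes are.
    top    = argmax (level ∘ head) d₀ face
    bottom = argmin (level ∘ head) d₀ face

    on-top : class top ≡ c
    on-top = argmax-all (level ∘ head) on-d₀ face-on

    on-bottom : class bottom ≡ c
    on-bottom = argmin-all (level ∘ head) on-d₀ face-on

    max : ∀ {d} → class d ≡ c → level (head d) ≤ level (head top)
    max on = All.lookup (f[xs]≤f[argmax] d₀ face) (∈-face on)

    min : ∀ {d} → class d ≡ c → level (head bottom) ≤ level (head d)
    min on = All.lookup (f[argmin]≤f[xs] d₀ face) (∈-face on)

    on-next : ∀ {d} → class d ≡ c → class (next d) ≡ c
    on-next on = trans (class-next _) on

    on-prev : ∀ {d} → class d ≡ c → class (prev d) ≡ c
    on-prev on = trans (class-prev _) on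

    not-above : ∀ {d} → class d ≡ c → level (tail d) ≤ level (head top)
    not-above {d} on = subst (λ v → level v ≤ _) (head-prev d) (max (on-prev on))

    not-below : ∀ {d} → class d ≡ c → level (head bottom) ≤ level (tail d)
    not-below {d} on = subst (λ v → _ ≤ level v) (head-prev d) (min (on-prev on))

    above : ∀ {d} → Rise (next d) → level (head d) < level (head (next d))
    above {d} r = ≤-reflexive (sym (trans r (cong (suc ∘ level) (tail-next d))))

    below : ∀ {d} → Fall (next d) → level (head (next d)) < level (head d)
    below {d} f = ≤-reflexive (trans (sym f) (cong level (tail-next d)))

    -- A double rise would take the face above its maximum just after `top`; a double fall would
    -- start above it.
    top∉ : top ∉ marks
    top∉ m with marks-double m
    ... | inj₁ (_ , r) = ℕ.<⇒≱ (above {top} r) (max (on-next on-top))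
    ... | inj₂ (f , _) = ℕ.<⇒≱ (≤-reflexive (sym f)) (not-above on-top)

    bottom∉ : bottom ∉ marks
    bottom∉ m with marks-double m
    ... | inj₁ (r , _) = ℕ.<⇒≱ (≤-reflexive (sym r)) (not-below on-bottom)
    ... | inj₂ (_ , f) = ℕ.<⇒≱ (below {bottom} f) (min (on-next on-bottom))

    flat-face : level (head top) ≡ level (head bottom) → Free c ⊎ (∀ d → class d ≡ c)
    -- Three consecutive darts are distinct unless the face has length two, and then it runs along
    -- one edge and back.
    flat-face eq with next (next d₀) ≟ᵈ d₀
    ... | no ¬2 = inj₁ (three (next-loopless d₀ ∘ sym) (¬2 ∘ sym) (next-loopless d₀ ∘ next-injective ∘ sym)
                          on-d₀ (on-next on-d₀) (on-next (on-next on-d₀))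
                          (unmarked on-d₀) (unmarked (on-next on-d₀)) (unmarked (on-next (on-next on-d₀))))
      where
      flat : ∀ {d} → class d ≡ c → Flat d
      flat on = ≤-antisym (≤-trans (not-above on) (≤-trans (≤-reflexive eq) (min on)))
                          (≤-trans (max on) (≤-trans (≤-reflexive eq) (not-below on)))
      unmarked : ∀ {d} → class d ≡ c → d ∉ marks
      unmarked {d} on m with marks-double m
      ... | inj₁ (r , _) = ¬rise∧flat d r (flat on)
      ... | inj₂ (f , _) = ¬fall∧flat d f (flat on)
    ... | yes two = inj₂ (reversible⇒all on-d₀ on-rev)
      where
      rev-d₀ : rev d₀ ≡ next d₀
      rev-d₀ = dart-≡ (sym (tail-next d₀)) (trans (sym (cong tail two)) (tail-next (next d₀)))
      on-rev : ∀ {d} → class d ≡ c → class (rev d) ≡ c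
      on-rev {d} on with orbit (trans on-d₀ (sym on))
      ... | k , refl with iterate-preserves (λ x → x ≡ d₀ ⊎ x ≡ next d₀)
                            (λ { (inj₁ refl) → inj₂ refl ; (inj₂ refl) → inj₁ two }) k (inj₁ refl)
      ... | inj₁ eq₁ = trans (cong (class ∘ rev) eq₁) (trans (cong class rev-d₀) (on-next on-d₀))
      ... | inj₂ eq₂ = trans (cong (class ∘ rev) (trans eq₂ (sym rev-d₀)))
                         (trans (cong class (rev-involutive d₀)) on-d₀)

    third? : Dec (Any.Any (λ d → d ≢ top × d ≢ bottom × d ∉ marks) face)
    third? = Any.any? (λ d → ¬? (d ≟ᵈ top) ×-dec ¬? (d ≟ᵈ bottom) ×-dec ¬? (d ∈? marks)) face

    by-height : Dec (level (head top) ≡ level (head bottom)) → Free c ⊎ (∀ d → class d ≡ c)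
    by-height (yes eq) = flat-face eq
    by-height (no top≢bottom) with third?
    ... | yes third with find third
    ...   | d , d∈ , d≢t , d≢b , d∉ = inj₁ (three (top≢bottom ∘ cong (level ∘ head)) (d≢t ∘ sym) (d≢b ∘ sym)
                                        on-top on-bottom (All.lookup face-on d∈) top∉ bottom∉ d∉)
    by-height (no top≢bottom) | no ¬third =
      inj₂ (reversible⇒all on-d₀ (bounce-reversible bounce (λ on → orbit (trans on-top (sym on)))))
      where
      cover : ∀ {d} → class d ≡ c → d ∈ marks ⊎ d ≡ top ⊎ d ≡ bottom
      cover {d} on with d ∈? marks | d ≟ᵈ top | d ≟ᵈ bottom
      ... | yes m | _     | _     = inj₁ m
      ... | no _  | yes t | _     = inj₂ (inj₁ t)
      ... | no _  | no _  | yes b = inj₂ (inj₂ b)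
      ... | no m  | no t  | no b  = contradiction (lose (∈-face on) (t , b , m)) ¬third
      bounce : Bounce G next prev (λ d → class d ≡ c) (_∈ marks)
      bounce = record
        { height = level ; _⋖_ = λ a b → b ≡ suc a ; _≼_ = _≤_
        ; ⋖-asym = λ { refl () }
        ; ⋖-injˡ = λ p q → ℕ.suc-injective (trans (sym p) q)
        ; ⋖-injʳ = λ p q → trans p (sym q)
        ; ⋖⇒⋡ = λ { refl → ℕ.1+n≰n }
        ; direction = slope ; next-prev = next-prev ; tail-next = tail-next
        ; on-next = on-next ; on-prev = on-prev
        ; marked = marks-double ; marked-thin = marks-thin
        ; top = top ; bottom = bottom ; on-top = on-top ; on-bottom = on-bottom
        ; max = max ; min = min ; top≢bottom = top≢bottom ; cover = cover
        }

  all⇒F≤1 : ∀ {c} → (∀ d → class d ≡ c) → F ≤ 1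
  all⇒F≤1 {c} all-c = subst (_≤ 1) (length-allFin F)
    (unique-⊆⇒length≤ {ys = c ∷ []} (allFin⁺ F) (λ {c′} _ → here (only c′)))
    where
    only : ∀ c′ → c′ ≡ c
    only c′ with surjective c′
    ... | d , eq = trans (sym (eq refl)) (all-c d)

  -- With two or more faces none contains every dart, so each is `Free`; these darts and the marks
  -- are distinct among the two darts per edge.
  face-bound : F ≤ 1 ⊎ F * 3 + length marks ≤ size + size
  face-bound with F ℕ.≤? 1
  ... | yes F≤1 = inj₁ F≤1
  ... | no F≰1  = inj₂ (begin
      F * 3 + length marks                                ≡⟨ cong (λ k → k * 3 + length marks) (length-allFin F) ⟨
      length (allFin F) * 3 + length marks
        ≡⟨ cong (_+ length marks) (length-concatMap-const free Fr.length≡3 (allFin F)) ⟨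
      length (concatMap free (allFin F)) + length marks   ≡⟨ length-++ (concatMap free (allFin F)) ⟨
      length (concatMap free (allFin F) ++ marks)         ≤⟨ unique-darts⇒length≤ all-unique ⟩
      size + size                                         ∎)
    where
    open ℕ.≤-Reasoning
    frees : ∀ c → Free c
    frees c with surjective c
    ... | d , eq with free-or-all (eq {d} refl)
    ... | inj₁ fr  = fr
    ... | inj₂ all = contradiction (all⇒F≤1 all) F≰1
    module Fr (c : Fin F) = Free (frees c)
    free : Fin F → List Dart
    free = Fr.free
    all-unique : Unique (concatMap free (allFin F) ++ marks)
    all-unique = Unique.++⁺
      (concatMap-unique free (λ {c} {c′} p q → trans (sym (Fr.free-class c p)) (Fr.free-class c′ q))
                        Fr.unique (allFin⁺ F))
      marks-unique
      (λ (d∈ , m) → let c , d∈c = ∈-concatMap⁻′ free {allFin F} d∈ in Fr.unmarked c d∈c m)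

-- Arithmetic with Euler's formula.

module _ (n m F : ℕ) (euler : n + F ≡ m + 2) where

  -- Three times Euler's formula is added to the two counts; the number `s` of marks occurs on both
  -- sides and cancels.
  bound-from-counts : ∀ {s D} → F * 3 + s ≤ m + m → D * 3 ≤ suc (n + s) → D * 3 + m + 4 ≤ 4 * n
  bound-from-counts {s} {D} faces≤ levels≤ =
    -- The counts give one unit more than is claimed: 5 in place of 4.
    ≤-trans (ℕ.+-monoʳ-≤ (D * 3 + m) (n≤1+n 4)) (ℕ.+-cancelʳ-≤ _ _ _ (begin
      D * 3 + m + 5 + (m + m + s + 1)                  ≡⟨ regroup₁ D m s ⟩
      D * 3 + s + 3 * (m + 2)                          ≡⟨ cong (λ k → D * 3 + s + 3 * k) euler ⟨
      D * 3 + s + 3 * (n + F)                          ≡⟨ regroup₂ D s n F ⟩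
      D * 3 + (F * 3 + s) + 3 * n
        ≤⟨ ℕ.+-monoˡ-≤ (3 * n) (ℕ.+-mono-≤ levels≤ faces≤) ⟩
      suc (n + s) + (m + m) + 3 * n                    ≡⟨ regroup₃ n s m ⟩
      4 * n + (m + m + s + 1)                          ∎))
    where
    open ℕ.≤-Reasoning
    regroup₁ : ∀ D m s → D * 3 + m + 5 + (m + m + s + 1) ≡ D * 3 + s + 3 * (m + 2)
    regroup₁ = solve-∀
    regroup₂ : ∀ D s n F → D * 3 + s + 3 * (n + F) ≡ D * 3 + (F * 3 + s) + 3 * n
    regroup₂ = solve-∀
    regroup₃ : ∀ n s m → suc (n + s) + (m + m) + 3 * n ≡ 4 * n + (m + m + s + 1)
    regroup₃ = solve-∀

  -- Euler's formula leaves at most `n - 1` edges, and `D` is at most `n - 1` as well.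
  bound-from-one-face : ∀ {D} → F ≤ 1 → D < n → D * 3 + m + 4 ≤ 4 * n
  bound-from-one-face {D} F≤1 D<n = begin
    D * 3 + m + 4            ≡⟨ regroup₁ D m ⟩
    3 * suc D + suc m        ≤⟨ ℕ.+-mono-≤ (ℕ.*-monoʳ-≤ 3 D<n) m<n ⟩
    3 * n + n                ≡⟨ regroup₂ n ⟩
    4 * n                    ∎
    where
    open ℕ.≤-Reasoning
    regroup₁ : ∀ D m → D * 3 + m + 4 ≡ 3 * suc D + suc m
    regroup₁ = solve-∀
    regroup₂ : ∀ n → 3 * n + n ≡ 4 * n
    regroup₂ = solve-∀
    m<n : m < n
    m<n = ℕ.+-cancelʳ-≤ 1 (suc m) n (begin
      suc m + 1 ≡⟨ ℕ.+-suc m 1 ⟨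
      m + 2     ≡⟨ euler ⟨
      n + F     ≤⟨ ℕ.+-monoʳ-≤ n F≤1 ⟩
      n + 1     ∎)

-- Euler's formula for a connected graph, and the bound on the diameter.

module _ {n : ℕ} (G : Graph n) (connected : Graph.Connected G) where
  open Graph G renaming (sym to adj-sym)

  -- Representatives of two classes would be joined by a path.
  one-component : ∀ {C} → Vertex → HasClasses Path C → C ≡ 1
  one-component {zero}        v cs with () ← HasClasses.class cs v
  one-component {suc zero}    v cs = refl
  one-component {suc (suc C)} v cs with surjective zero | surjective (suc zero)
    where open HasClasses cs
  ... | x , class-x | y , class-y
    with () ← trans (sym (class-x refl)) (trans (Equivalence.to (HasClasses.classifies cs x y)
                                                   (proj₂ connected x y)) (class-y refl))

  -- Every vertex differs from `u` or from `v`, and a walk to that one starts with an edge.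
  no-isolated : ∀ {u v} → u ≢ v → #isolated ≡ 0
  no-isolated {u} {v} u≢v = cong length (filter-none isolated? {allFin n} (All.tabulate (λ {x} _ → joined x)))
    where
    first-step : ∀ {x y} → Walk x y → x ≢ y → ¬ Isolated x
    first-step ε       x≢y _   = x≢y refl
    first-step (a ◅ _) _   iso = iso _ a

    joined : ∀ x → ¬ Isolated x
    joined x with x ≟ u
    ... | yes refl = first-step (proj₁ (proj₂ connected x v)) u≢v
    ... | no x≢u   = first-step (proj₁ (proj₂ connected x u)) x≢u

-- Two distinct vertices exclude isolated ones, so `euler` takes the form `n + #faces ≡ size + 2`.
level-bound : ∀ {n} (G : Graph n) → Graph.Connected G → Planar G →
              ∀ {root} (L : Levels G root) {x y : Fin n} → x ≢ y →
              ∀ u → Levels.level L u * 3 + Graph.size G + 4 ≤ 4 * n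
level-bound {n} G connected P L x≢y u = bound face-bound
  where
  open Graph G using (size; #isolated)
  open PlaneEmbedding P
  open Faces G connected L rotationSystem u faces

  euler′ : n + #faces ≡ size + 2
  euler′ = begin
    n + #faces                ≡⟨ cong (n +_) (ℕ.+-identityʳ #faces) ⟨
    n + (#faces + 0)          ≡⟨ cong (λ k → n + (#faces + k)) (no-isolated G connected x≢y) ⟨
    n + (#faces + #isolated)  ≡⟨ euler ⟩
    size + 2 * #components    ≡⟨ cong (λ k → size + 2 * k) (one-component G connected u components) ⟩
    size + 2                  ∎
    where open ≡-Reasoning

  bound : #faces ≤ 1 ⊎ #faces * 3 + length marks ≤ size + size →
          Levels.level L u * 3 + size + 4 ≤ 4 * n
  bound (inj₁ one-face) =
    bound-from-one-face n size #faces euler′ {Levels.level L u} one-face (Levels.level< L u)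
  bound (inj₂ faces≤)   =
    bound-from-counts n size #faces euler′ {length marks} {Levels.level L u} faces≤ marks-enough

diameter-bound : ∀ n (G : Graph n) → Graph.Connected G → Planar G →
                 ∀ D → Graph.IsDiameter G D → D * 3 + Graph.size G + 4 ≤ 4 * n
diameter-bound zero          G _         _ D ((() , _) , _)
-- A single vertex is isolated and its face is counted by `#isolated`, so this case stands apart.
diameter-bound (suc zero)    G connected _ D ((u , v , dist) , _) =
  single (ℕ.≤-<-trans (distance≤level dist) (level< u))
  where
  open Levels (levels G connected v)
  single : D < 1 → D * 3 + Graph.size G + 4 ≤ 4
  -- On one vertex no pair is increasing, so `size` computes to 0.
  single (s≤s z≤n) = ≤-refl
diameter-bound (suc (suc _)) G connected P D ((u , v , dist) , _) = ≤-trans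
  (ℕ.+-monoˡ-≤ 4 (ℕ.+-monoˡ-≤ (Graph.size G) (ℕ.*-monoˡ-≤ 3 (Levels.distance≤level L dist))))
  (level-bound G connected P L {zero} {suc zero} (λ ()) u)
  where L = levels G connected v

-- Passage to integers and rationals.

open ℤ using (+_)
open ℚ using (_/_)

-- The factors `+ 3` and `+ 1` are the denominators in the cross-multiplied comparison of the two
-- fractions.
ℤ-bound : ∀ n m D → D * 3 + m + 4 ≤ 4 * n →
          + D ℤ.* + 3 ℤ.≤ (+ 4 ℤ.* (+ n ℤ.- + 1) ℤ.- + m) ℤ.* + 1
ℤ-bound n m D bound = begin
  + D ℤ.* + 3                                        ≡⟨ regroup₁ (+ D) (+ m) ⟩
  (+ D ℤ.* + 3 ℤ.+ + m ℤ.+ + 4) ℤ.+ (ℤ.- + m ℤ.- + 4)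
    ≡⟨ cong (λ i → i ℤ.+ + m ℤ.+ + 4 ℤ.+ (ℤ.- + m ℤ.- + 4)) (ℤₚ.pos-* D 3) ⟨
  + (D * 3 + m + 4) ℤ.+ (ℤ.- + m ℤ.- + 4)            ≤⟨ ℤₚ.+-monoˡ-≤ (ℤ.- + m ℤ.- + 4) (ℤ.+≤+ bound) ⟩
  + (4 * n) ℤ.+ (ℤ.- + m ℤ.- + 4)                    ≡⟨ cong (ℤ._+ _) (ℤₚ.pos-* 4 n) ⟩
  + 4 ℤ.* + n ℤ.+ (ℤ.- + m ℤ.- + 4)                  ≡⟨ regroup₂ (+ n) (+ m) ⟩
  (+ 4 ℤ.* (+ n ℤ.- + 1) ℤ.- + m) ℤ.* + 1            ∎
  where
  open ℤₚ.≤-Reasoning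
  regroup₁ : ∀ x y → x ℤ.* + 3 ≡ (x ℤ.* + 3 ℤ.+ y ℤ.+ + 4) ℤ.+ (ℤ.- y ℤ.- + 4)
  regroup₁ = ℤ-Solver.solve-∀
  regroup₂ : ∀ x y → + 4 ℤ.* x ℤ.+ (ℤ.- y ℤ.- + 4) ≡ (+ 4 ℤ.* (x ℤ.- + 1) ℤ.- y) ℤ.* + 1
  regroup₂ = ℤ-Solver.solve-∀

theorem2 : (n : ℕ) (G : Graph n) → Graph.Connected G → Planar G →
    (D : ℕ) → Graph.IsDiameter G D →
    (+ D) / 1 ℚ.≤ (+ 4 ℤ.* (+ n ℤ.- + 1) ℤ.- + Graph.size G) / 3
theorem2 n G connected planar D diameter =
  ℚₚ.toℚᵘ-cancel-≤ (begin
    -- Unnormalised fractions store the denominator minus one: `0` stands for 1 and `2` for 3.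
    ℚ.toℚᵘ (+ D / 1)    ≃⟨ ℚₚ.toℚᵘ-fromℚᵘ (ℚᵘ.mkℚᵘ (+ D) 0) ⟩
    ℚᵘ.mkℚᵘ (+ D) 0     ≤⟨ ℚᵘ.*≤* (ℤ-bound n size D (diameter-bound n G connected planar D diameter)) ⟩
    ℚᵘ.mkℚᵘ bound 2     ≃⟨ ℚₚ.toℚᵘ-fromℚᵘ (ℚᵘ.mkℚᵘ bound 2) ⟨
    ℚ.toℚᵘ (bound / 3)  ∎)
  where
  open Graph G using (size)
  open ℚᵘₚ.≤-Reasoning
  bound = + 4 ℤ.* (+ n ℤ.- + 1) ℤ.- + size
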